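{- Let $n \geq m \geq 2$ be integers and let $v$ be any vertex of the rectangular lattice $L_{n,m}$. If at least one of $n$ and $m$ is odd, then $$f_d(L_{n,m}, v) = n+m-1.$$ Otherwise (that is, if $n$ and $m$ are both even), $$n+m \leq f_d(L_{n,m}, v) \leq 2m+n-2.$$
   Context: $L_{n,m}$ denotes the $n$ by $m$ rectangular lattice (grid graph) on $nm$ vertices, i.e. the Cartesian product of a path on $n$ vertices and a path on $m$ vertices: its vertices are pairs $(x,y)$ with $1\le x\le n$, $1\le y\le m$, and two vertices are adjacent iff they agree in one coordinate and differ by exactly $1$ in the other. Explorer-Director game on a connected graph $G$ with starting vertex $v$: a token is initially at $v$ (so $v$ counts as visited). On each turn the Explorer names a distance $d$ such that at least one vertex of $G$ is at (shortest-path) distance exactly $d$ from the token's current position, and then the Director moves the token to a vertex of their choice at distance exactly $d$ from the current position. The Explorer wants to maximize, and the Director to minimize, the number of distinct vertices visited by the token; play continues until the Explorer can no longer force the token onto an unvisited vertex. $f_d(G,v)$ is the number of visited vertices at the end of the game under optimal play by both players; equivalently, it is the largest $k$ such that the Explorer has a (possibly adaptive) strategy guaranteeing, against every play of the Director, that at least $k$ distinct vertices (including $v$) are visited after finitely many turns. -}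

module Defs where

open import Data.Empty using (⊥-elim)
open import Data.Fin using (Fin; zero; suc; toℕ)
import Data.Fin.Properties as Fin
open import Data.List using (List; []; _∷_; [_]; length; lookup; deduplicate; allFin; cartesianProduct)
open import Data.List.Membership.Propositional using (_∈_; _∉_; lose; find)
open import Data.List.Membership.Propositional.Properties
  using (∈-lookup; ∈-allFin; ∈-cartesianProduct⁺; ∈-deduplicate⁺; ∈-deduplicate⁻)
open import Data.List.Relation.Binary.Subset.Propositional using (_⊆_)
open import Data.List.Relation.Unary.All using (All; []; _∷_)
import Data.List.Relation.Unary.All as All
import Data.List.Relation.Unary.All.Properties as All
open import Data.List.Relation.Unary.Any using (here; there; index; any?)
open import Data.List.Relation.Unary.Any.Properties using (lookup-index)
open import Data.List.Relation.Unary.AllPairs using ([]; _∷_)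
open import Data.List.Relation.Unary.Unique.Propositional using (Unique)
import Data.List.Relation.Unary.Unique.DecPropositional.Properties as DecUnique
open import Data.Nat using (ℕ; zero; suc; _+_; _≤_; _<_; z≤n; s≤s; ∣_-_∣)
import Data.Nat.Properties as ℕ
open import Data.Product using (∃; _×_; _,_; proj₁; proj₂)
open import Data.Product.Properties using (≡-dec)
open import Data.Sum using (_⊎_; inj₁; inj₂)
open import Relation.Binary.Definitions using (DecidableEquality; Decidable; Symmetric; Irreflexive)
open import Relation.Binary.PropositionalEquality
  using (_≡_; refl; sym; trans; cong; subst)
open import Relation.Nullary using (¬_; Dec; yes; no)
open import Relation.Nullary.Decidable using (_×-dec_; _⊎-dec_; _→-dec_; ¬?; map′)

data Walk {V : Set} (_~_ : V → V → Set) : V → V → ℕ → Set where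
  nil  : ∀ {u} → Walk _~_ u u 0
  step : ∀ {u v w ℓ} → u ~ v → Walk _~_ v w ℓ → Walk _~_ u w (suc ℓ)

record ConnectedGraph : Set₁ where
  infix 4 _~_
  field
    V         : Set
    _~_       : V → V → Set
    ~-sym     : Symmetric _~_
    ~-irrefl  : Irreflexive _≡_ _~_
    _≟_       : DecidableEquality V
    _~?_      : Decidable _~_
    vertices  : List V
    complete  : ∀ v → v ∈ vertices
    connected : ∀ u v → ∃ λ ℓ → Walk _~_ u v ℓ

  Distance : V → V → ℕ → Set
  Distance u v d = Walk _~_ u v d × (∀ {ℓ} → Walk _~_ u v ℓ → d ≤ ℓ)

  countDistinct : List V → ℕ
  countDistinct h = length (deduplicate _≟_ h)

  -- Guarantees k p h: with the token on p and the list h of vertices visited so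
  -- far, the Explorer has a strategy that makes the number of distinct visited
  -- vertices at least k after finitely many further turns.  A derivation is the
  -- strategy tree: the Explorer picks one distance at each node and the tree
  -- branches over all replies of the Director.
  data Guarantees (k : ℕ) (p : V) (h : List V) : Set where
    done : k ≤ countDistinct h → Guarantees k p h
    move : ∀ d → (∃ λ u → Distance p u d) →
           (∀ u → Distance p u d → Guarantees k u (u ∷ h)) →
           Guarantees k p h

  IsGameValue : V → ℕ → Set
  IsGameValue v k = Guarantees k v [ v ] × (∀ j → Guarantees j v [ v ] → j ≤ k)

open ConnectedGraph using (V)

-- The remainder up to gameValue shows that the game value exists; the
-- existence of a largest guaranteed k is not automatic constructively.

lookup-unique-injective : ∀ {A : Set} {xs : List A} → Unique xs →
                          ∀ {i j} → lookup xs i ≡ lookup xs j → i ≡ j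
lookup-unique-injective (_  ∷ _)  {zero}  {zero}  _  = refl
lookup-unique-injective (px ∷ _)  {zero}  {suc j} eq = ⊥-elim (All.lookup px (∈-lookup j) eq)
lookup-unique-injective (px ∷ _)  {suc i} {zero}  eq = ⊥-elim (All.lookup px (∈-lookup i) (sym eq))
lookup-unique-injective (_  ∷ un) {suc i} {suc j} eq = cong suc (lookup-unique-injective un eq)

unique-⊆⇒length-≤ : ∀ {A : Set} {xs ys : List A} → Unique xs → xs ⊆ ys → length xs ≤ length ys
unique-⊆⇒length-≤ {xs = xs} {ys} un sub = Fin.injective⇒≤ {f = f} inj
  where
  f : Fin (length xs) → Fin (length ys)
  f i = index (sub (∈-lookup i))

  inj : ∀ {i j} → f i ≡ f j → i ≡ j
  inj {i} {j} eq = lookup-unique-injective un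
    (trans (lookup-index (sub (∈-lookup i)))
      (trans (cong (lookup ys) eq) (sym (lookup-index (sub (∈-lookup j))))))

least : ∀ {P : ℕ → Set} → (∀ n → Dec (P n)) → ∀ {n} → P n →
        ∃ λ m → P m × (∀ {j} → P j → m ≤ j)
least P? {zero}  pn = 0 , pn , λ _ → z≤n
least {P} P? {suc n} pn with P? 0
... | yes p0 = 0 , p0 , λ _ → z≤n
... | no ¬p0 with least {λ j → P (suc j)} (λ j → P? (suc j)) pn
...   | m , pm , min = suc m , pm , below
  where
  below : ∀ {j} → P j → suc m ≤ j
  below {zero}  p0 = ⊥-elim (¬p0 p0)
  below {suc j} pj = s≤s (min pj)

greatest : ∀ {P : ℕ → Set} → (∀ n → Dec (P n)) → P 0 → ∀ b → (∀ j → P j → j ≤ b) →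
           ∃ λ m → P m × (∀ j → P j → j ≤ m)
greatest P? p0 zero    bd = 0 , p0 , bd
greatest P? p0 (suc b) bd with P? (suc b)
... | yes p = suc b , p , bd
... | no ¬p = greatest P? p0 b λ j pj →
        ℕ.≤-pred (ℕ.≤∧≢⇒< (bd j pj) λ { refl → ¬p pj })

module GameValue (G : ConnectedGraph) where
  open ConnectedGraph G hiding (V)
  open import Data.List.Membership.DecPropositional _≟_ using (_∈?_)

  allV? : ∀ {P : V G → Set} → (∀ u → Dec (P u)) → Dec (∀ u → P u)
  allV? P? = map′ (λ a u → All.lookup a (complete u)) (λ f → All.tabulate λ {u} _ → f u)
                  (All.all? P? vertices)

  anyV? : ∀ {P : V G → Set} → (∀ u → Dec (P u)) → Dec (∃ P)
  anyV? P? = map′ (λ a → let u , _ , p = find a in u , p) (λ (u , p) → lose (complete u) p)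
                  (any? P? vertices)

  walk? : ∀ u v ℓ → Dec (Walk _~_ u v ℓ)
  walk? u v zero    = map′ (λ { refl → nil }) (λ { nil → refl }) (u ≟ v)
  walk? u v (suc ℓ) = map′ (λ (_ , e , w) → step e w) (λ { (step e w) → _ , e , w })
                           (anyV? λ x → (u ~? x) ×-dec walk? x v ℓ)

  distance : ∀ u v → ∃ (Distance u v)
  distance u v = least (walk? u v) (proj₂ (connected u v))

  dist : V G → V G → ℕ
  dist u v = proj₁ (distance u v)

  Distance⇒≡ : ∀ {u v d} → Distance u v d → dist u v ≡ d
  Distance⇒≡ {u} {v} (w , min) =
    let w′ , min′ = proj₂ (distance u v) in ℕ.≤-antisym (min′ w) (min w′)

  ≡⇒Distance : ∀ {u v d} → dist u v ≡ d → Distance u v d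
  ≡⇒Distance {u} {v} refl = proj₂ (distance u v)

  count-≥ : ∀ xs h → Unique xs → xs ⊆ h → length xs ≤ countDistinct h
  count-≥ xs h un sub = unique-⊆⇒length-≤ un λ x∈ → ∈-deduplicate⁺ _≟_ (sub x∈)

  count-mono : ∀ h h′ → h ⊆ h′ → countDistinct h ≤ countDistinct h′
  count-mono h h′ sub = count-≥ (deduplicate _≟_ h) h′ (DecUnique.deduplicate-! _≟_ h) λ x∈ → sub (∈-deduplicate⁻ _≟_ h x∈)

  count-bound : ∀ h → countDistinct h ≤ length vertices
  count-bound h = unique-⊆⇒length-≤ {ys = vertices} (DecUnique.deduplicate-! _≟_ h) λ {x} _ → complete x

  fresh : ∀ {u : V G} {xs} → u ∉ xs → Unique xs → Unique (u ∷ xs)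
  fresh u∉ un = All.¬Any⇒All¬ _ u∉ ∷ un

  count-fresh : ∀ {u h} → u ∉ h → countDistinct h < countDistinct (u ∷ h)
  count-fresh {u} {h} u∉ = count-≥ (u ∷ deduplicate _≟_ h) (u ∷ h)
    (fresh (λ u∈ → u∉ (∈-deduplicate⁻ _≟_ h u∈)) (DecUnique.deduplicate-! _≟_ h))
    λ { (here e) → here e ; (there x∈) → there (∈-deduplicate⁻ _≟_ h x∈) }

  ∷-mono : ∀ {u : V G} {h h′} → h ⊆ h′ → (u ∷ h) ⊆ (u ∷ h′)
  ∷-mono sub (here e)   = here e
  ∷-mono sub (there x∈) = there (sub x∈)

  Guarantees-mono : ∀ {k p h h′} → h ⊆ h′ → Guarantees k p h → Guarantees k p h′
  Guarantees-mono {h = h} {h′} sub (done c) = done (ℕ.≤-trans c (count-mono h h′ sub))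
  Guarantees-mono sub (move d ne f) = move d ne λ u δ → Guarantees-mono (∷-mono sub) (f u δ)

  Guarantees-bound : ∀ {k p h} → Guarantees k p h → k ≤ length vertices
  Guarantees-bound {h = h} (done c)        = ℕ.≤-trans c (count-bound h)
  Guarantees-bound (move _ (u , δ) f)     = Guarantees-bound (f u δ)

  -- Backward induction.  While no new vertex is visited only the position
  -- matters, so for fixed h the winning positions are found by enlarging a
  -- list W of winning positions until no further position can be added.
  module Attractor (k : ℕ) (h : List (V G)) (k≰ : ¬ (k ≤ countDistinct h))
                   (new? : ∀ u → u ∉ h → Dec (Guarantees k u (u ∷ h))) where

    Good : List (V G) → V G → Set
    Good W u = u ∈ W ⊎ (u ∉ h × Guarantees k u (u ∷ h))

    good? : ∀ W u → Dec (Good W u)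
    good? W u = (u ∈? W) ⊎-dec dec
      where
      dec : Dec (u ∉ h × Guarantees k u (u ∷ h))
      dec with u ∈? h
      ... | yes u∈ = no λ (u∉ , _) → u∉ u∈
      ... | no  u∉ = map′ (u∉ ,_) proj₂ (new? u u∉)

    Wins : List (V G) → V G → Set
    Wins W p = ∃ λ w → ∀ u → dist p u ≡ dist p w → Good W u

    wins? : ∀ W p → Dec (Wins W p)
    wins? W p = anyV? λ w → allV? λ u → (dist p u ℕ.≟ dist p w) →-dec good? W u

    sound : ∀ {W p} → All (λ q → Guarantees k q h) W → Wins W p → Guarantees k p h
    sound {W} {p} aw (w , f) = move (dist p w) (w , ≡⇒Distance refl) λ u δ → reply (f u (Distance⇒≡ δ))
      where
      reply : ∀ {u} → Good W u → Guarantees k u (u ∷ h)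
      reply (inj₁ u∈)      = Guarantees-mono there (All.lookup aw u∈)
      reply (inj₂ (_ , g)) = g

    closed : ∀ {W} → ¬ (∃ λ p → p ∉ W × Wins W p) →
             ∀ {p h′} → h ⊆ h′ → h′ ⊆ h → Guarantees k p h′ → p ∈ W
    closed stop {h′ = h′} sub sup (done c) = ⊥-elim (k≰ (ℕ.≤-trans c (count-mono h′ h sup)))
    closed {W} stop {p} sub sup (move d (w , δw) f) with p ∈? W
    ... | yes p∈ = p∈
    ... | no  p∉ = ⊥-elim (stop (p , p∉ , w , λ u e → reply u (≡⇒Distance (trans e (Distance⇒≡ δw)))))
      where
      reply : ∀ u → Distance p u d → Good W u
      reply u δ with u ∈? h
      ... | yes u∈ = inj₁ (closed stop (λ x∈ → there (sub x∈))
                       (λ { (here refl) → u∈ ; (there x∈) → sup x∈ }) (f u δ))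
      ... | no  u∉ = inj₂ (u∉ , Guarantees-mono (∷-mono sup) (f u δ))

    iterate : ∀ fuel W → Unique W → length vertices < fuel + length W →
              All (λ q → Guarantees k q h) W → ∀ p → Dec (Guarantees k p h)
    iterate zero W un lt aw p = ⊥-elim (ℕ.<⇒≱ lt (unique-⊆⇒length-≤ {ys = vertices} un λ {x} _ → complete x))
    iterate (suc fuel) W un lt aw p with anyV? (λ q → ¬? (q ∈? W) ×-dec wins? W q)
    ... | yes (q , q∉ , wq) =
            iterate fuel (q ∷ W) (fresh q∉ un)
              (subst (length vertices <_) (sym (ℕ.+-suc fuel (length W))) lt) (sound aw wq ∷ aw) p
    ... | no stop = map′ (All.lookup aw) (closed stop (λ x∈ → x∈) (λ x∈ → x∈)) (p ∈? W)

  guarantees-fuel? : ∀ fuel k p h → k ≤ fuel + countDistinct h → Dec (Guarantees k p h)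
  guarantees-fuel? zero       k p h le = yes (done le)
  guarantees-fuel? (suc fuel) k p h le with k ℕ.≤? countDistinct h
  ... | yes c = yes (done c)
  ... | no ¬c = Attractor.iterate k h ¬c new? (suc (length vertices)) [] []
                  (s≤s (ℕ.m≤m+n _ 0)) [] p
    where
    new? : ∀ u → u ∉ h → Dec (Guarantees k u (u ∷ h))
    new? u u∉ = guarantees-fuel? fuel k u (u ∷ h)
      (ℕ.≤-trans le (subst (_≤ fuel + countDistinct (u ∷ h)) (ℕ.+-suc fuel _)
        (ℕ.+-monoʳ-≤ fuel (count-fresh u∉))))

  guarantees? : ∀ k p h → Dec (Guarantees k p h)
  guarantees? k p h = guarantees-fuel? k k p h (ℕ.m≤m+n k _)

  gameValue-exists : ∀ v → ∃ (IsGameValue v)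
  gameValue-exists v = greatest (λ k → guarantees? k v [ v ]) (done z≤n)
                                (length vertices) (λ _ → Guarantees-bound)

abstract
  -- The number written f_d(G, v).  It is abstract to keep the search above from
  -- being unfolded; gameValue-isGameValue characterizes it uniquely.
  gameValue : (G : ConnectedGraph) → V G → ℕ
  gameValue G v = proj₁ (GameValue.gameValue-exists G v)

  gameValue-isGameValue : ∀ G v → ConnectedGraph.IsGameValue G v (gameValue G v)
  gameValue-isGameValue G v = proj₂ (GameValue.gameValue-exists G v)

mapWalk : ∀ {A B : Set} {R : A → A → Set} {S : B → B → Set} (f : A → B) →
          (∀ {x y} → R x y → S (f x) (f y)) → ∀ {x y ℓ} → Walk R x y ℓ → Walk S (f x) (f y) ℓ
mapWalk f g nil        = nil
mapWalk f g (step e w) = step (g e) (mapWalk f g w)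

appendWalk : ∀ {A : Set} {R : A → A → Set} {x y z k ℓ} →
             Walk R x y k → Walk R y z ℓ → Walk R x z (k + ℓ)
appendWalk nil        w′ = w′
appendWalk (step e w) w′ = step e (appendWalk w w′)

PathAdj : ∀ {n} → Fin n → Fin n → Set
PathAdj i j = ∣ toℕ i - toℕ j ∣ ≡ 1

pathWalk : ∀ {n} (i j : Fin n) → ∃ λ ℓ → Walk PathAdj i j ℓ
pathWalk zero    zero    = 0 , nil
pathWalk {suc (suc n)} zero (suc j) =
  let ℓ , w = pathWalk zero j in suc ℓ , step refl (mapWalk suc (λ e → e) w)
pathWalk {suc (suc n)} (suc i) zero =
  let ℓ , w = pathWalk i zero in ℓ + 1 , appendWalk (mapWalk suc (λ e → e) w) (step refl nil)
pathWalk (suc i) (suc j) = let ℓ , w = pathWalk i j in ℓ , mapWalk suc (λ e → e) w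

path : ℕ → ConnectedGraph
path n = record
  { V         = Fin n
  ; _~_       = PathAdj
  ; ~-sym     = λ {i} {j} e → trans (ℕ.∣-∣-comm (toℕ j) (toℕ i)) e
  ; ~-irrefl  = λ { {i} refl e → ℕ.0≢1+n (trans (sym (ℕ.∣n-n∣≡0 (toℕ i))) e) }
  ; _≟_       = Fin._≟_
  ; _~?_      = λ i j → ∣ toℕ i - toℕ j ∣ ℕ.≟ 1
  ; vertices  = allFin n
  ; complete  = ∈-allFin
  ; connected = pathWalk
  }

infixr 5 _□_

_□_ : ConnectedGraph → ConnectedGraph → ConnectedGraph
G □ H = record
  { V         = V G × V H
  ; _~_       = λ (x , y) (x′ , y′) → (x ≡ x′ × y H.~ y′) ⊎ (y ≡ y′ × x G.~ x′)
  ; ~-sym     = λ { (inj₁ (e , a)) → inj₁ (sym e , H.~-sym a)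
                  ; (inj₂ (e , a)) → inj₂ (sym e , G.~-sym a) }
  ; ~-irrefl  = λ { refl (inj₁ (_ , a)) → H.~-irrefl refl a
                  ; refl (inj₂ (_ , a)) → G.~-irrefl refl a }
  ; _≟_       = ≡-dec G._≟_ H._≟_
  ; _~?_      = λ (x , y) (x′ , y′) → ((x G.≟ x′) ×-dec (y H.~? y′)) ⊎-dec ((y H.≟ y′) ×-dec (x G.~? x′))
  ; vertices  = cartesianProduct G.vertices H.vertices
  ; complete  = λ (x , y) → ∈-cartesianProduct⁺ (G.complete x) (H.complete y)
  ; connected = λ (x , y) (x′ , y′) →
      let k , w = G.connected x x′
          ℓ , z = H.connected y y′
      in k + ℓ , appendWalk (mapWalk (_, y) (λ a → inj₂ (refl , a)) w)
                            (mapWalk (x′ ,_) (λ a → inj₁ (refl , a)) z)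
  }
  where
  module G = ConnectedGraph G
  module H = ConnectedGraph H

-- The n by m lattice, with coordinates counted from 0.
L : ℕ → ℕ → ConnectedGraph
L n m = path n □ path m

{-# OPTIONS --safe #-}
module Submission where

open import Defs
open import Data.Nat using (ℕ; _+_; _*_; _∸_; _≤_)
open import Data.Nat.Divisibility using (_∣_)
open import Data.Product using (_×_)
open import Data.Sum using (_⊎_)
open import Relation.Binary.PropositionalEquality using (_≡_)
open import Relation.Nullary using (¬_)

open import Data.Bool using (Bool; true; false; not; _xor_)
import Data.Bool.Properties as Bool
open import Data.Empty using (⊥-elim)
open import Data.Fin using (Fin; zero; suc; toℕ; fromℕ; fromℕ<)
import Data.Fin.Properties as Fin
open import Data.List using (List; []; _∷_; [_]; _++_; length; map; applyUpTo; upTo; deduplicate)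
import Data.List.Membership.DecPropositional as DecMembership
open import Data.List.Membership.Propositional using (_∈_; find)
open import Data.List.Membership.Propositional.Properties
  using (∈-map⁺; ∈-map⁻; ∈-++⁺ˡ; ∈-++⁺ʳ; ∈-applyUpTo⁺; ∈-upTo⁻; ∈-deduplicate⁺; ∈-deduplicate⁻)
open import Data.List.Properties using (length-++; length-applyUpTo; length-map; length-upTo)
open import Data.List.Relation.Unary.All using (All; []; _∷_)
import Data.List.Relation.Unary.All as All
open import Data.List.Relation.Unary.All.Properties using (¬All⇒Any¬)
open import Data.List.Relation.Unary.Any using (there)
import Data.List.Relation.Unary.Unique.DecPropositional.Properties as DecUnique
import Data.List.Relation.Unary.Unique.Propositional.Properties as Unique
open import Data.Nat using (zero; suc; _<_; z≤n; s≤s; ∣_-_∣; _⊔_)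
import Data.Nat as ℕ
open import Data.Nat.Divisibility using (divides; _∣?_; ∣m∣n⇒∣m+n; ∣m+n∣m⇒∣n; ∣1⇒≡1; ∣-refl)
open import Data.Nat.Properties hiding (_≟_)
open import Data.Nat.Tactic.RingSolver using (solve-∀)
open import Data.Product using (∃; _,_; proj₁; proj₂)
open import Data.Sum using (inj₁; inj₂; [_,_]′)
open import Function using (_∘_)
open import Relation.Binary.Construct.Closure.ReflexiveTransitive using (Star; ε; _◅_; _◅◅_; reverse)
open import Relation.Binary.PropositionalEquality
  using (_≢_; refl; sym; trans; cong; cong₂; subst; module ≡-Reasoning)
open import Relation.Nullary using (yes; no)

-- Lower bounds.  Naming the eccentricity of the current vertex brings the token to a corner.  From a
-- corner the Explorer can force any level of the distance to that corner; the two corners of one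
-- diagonal have the same levels.  As long as fewer than n + m − 1 vertices are visited, each diagonal
-- has an unvisited level.  If n and m are even, a vertex has an even level on exactly one diagonal and
-- there are (n + m) / 2 even levels on each, so with fewer than n + m visited vertices some level is
-- missing on some diagonal, and the Explorer can change diagonals.
--
-- Upper bounds.  The Director stays inside a set of vertices that is connected and contains, with each
-- vertex, one that is farthest from it in the whole lattice: a monotone staircase between opposite
-- corners that crosses along the middle column when n (or, transposed, m) is odd, and in general
-- the row of the starting vertex together with the two outer columns.

-- The taxicab metric on grid points

Point : Set
Point = ℕ × ℕ

Box : ℕ → ℕ → Point → Set
Box a b (x , y) = x ≤ a × y ≤ b

ρ : Point → Point → ℕ
ρ (x , y) (x′ , y′) = ∣ x - x′ ∣ + ∣ y - y′ ∣

+-interchange : ∀ p q r s → (p + q) + (r + s) ≡ (p + r) + (q + s)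
+-interchange = solve-∀

ρ-refl : ∀ z → ρ z z ≡ 0
ρ-refl (x , y) = cong₂ _+_ (∣n-n∣≡0 x) (∣n-n∣≡0 y)

ρ-sym : ∀ z w → ρ z w ≡ ρ w z
ρ-sym (x , y) (x′ , y′) = cong₂ _+_ (∣-∣-comm x x′) (∣-∣-comm y y′)

ρ-triangle : ∀ z w v → ρ z v ≤ ρ z w + ρ w v
ρ-triangle (x , y) (x′ , y′) (x″ , y″) = ≤-trans
  (+-mono-≤ (∣-∣-triangle x x′ x″) (∣-∣-triangle y y′ y″))
  (≤-reflexive (+-interchange (∣ x - x′ ∣) _ (∣ y - y′ ∣) _))

-- Graph distance in the lattice as taxicab distance of coordinates

Vertex : ℕ → ℕ → Set
Vertex n m = ConnectedGraph.V (L n m)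

module _ {n m : ℕ} where
  coords : Vertex n m → Point
  coords (i , j) = toℕ i , toℕ j

  coords-injective : ∀ {u v} → coords u ≡ coords v → u ≡ v
  coords-injective e = cong₂ _,_ (Fin.toℕ-injective (cong proj₁ e)) (Fin.toℕ-injective (cong proj₂ e))

  δ : Vertex n m → Vertex n m → ℕ
  δ u v = ρ (coords u) (coords v)

coords-Box : ∀ {a b} (u : Vertex (suc a) (suc b)) → Box a b (coords u)
coords-Box (i , j) = Fin.toℕ≤pred[n] i , Fin.toℕ≤pred[n] j

vertexAt : ∀ {a b z} → Box a b z → ∃ λ (u : Vertex (suc a) (suc b)) → coords u ≡ z
vertexAt (x≤a , y≤b) = (fromℕ< (s≤s x≤a) , fromℕ< (s≤s y≤b)) ,
  cong₂ _,_ (Fin.toℕ-fromℕ< (s≤s x≤a)) (Fin.toℕ-fromℕ< (s≤s y≤b))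

pathGeodesic : ∀ {n} (i j : Fin n) → Walk PathAdj i j (∣ toℕ i - toℕ j ∣)
pathGeodesic zero zero = nil
pathGeodesic {suc (suc n)} zero (suc j) = step refl (mapWalk suc (λ e → e) (pathGeodesic zero j))
pathGeodesic {suc (suc n)} (suc i) zero = subst (Walk PathAdj (suc i) zero)
  (trans (cong (_+ 1) (∣-∣-identityʳ (toℕ i))) (+-comm (toℕ i) 1))
  (appendWalk (mapWalk suc (λ e → e) (pathGeodesic i zero)) (step refl nil))
pathGeodesic (suc i) (suc j) = mapWalk suc (λ e → e) (pathGeodesic i j)

module _ {n m : ℕ} where
  open ConnectedGraph (L n m) using (_~_; Distance)

  geodesic : ∀ u v → Walk _~_ u v (δ u v)
  geodesic (i , j) (i′ , j′) =
    appendWalk (mapWalk (_, j) (λ a → inj₂ (refl , a)) (pathGeodesic i i′))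
               (mapWalk (i′ ,_) (λ a → inj₁ (refl , a)) (pathGeodesic j j′))

  adjacent⇒δ≡1 : ∀ {u v} → u ~ v → δ u v ≡ 1
  adjacent⇒δ≡1 {i , _} (inj₁ (refl , e)) = cong₂ _+_ (∣n-n∣≡0 (toℕ i)) e
  adjacent⇒δ≡1 {_ , j} (inj₂ (refl , e)) = cong₂ _+_ e (∣n-n∣≡0 (toℕ j))

  δ≤walk : ∀ {u v ℓ} → Walk _~_ u v ℓ → δ u v ≤ ℓ
  δ≤walk {u} nil = ≤-reflexive (ρ-refl (coords u))
  δ≤walk {u} {w} (step {v = v} e p) = ≤-trans (ρ-triangle (coords u) (coords v) (coords w))
    (+-mono-≤ (≤-reflexive (adjacent⇒δ≡1 e)) (δ≤walk p))

  δ≡⇒Distance : ∀ {u v d} → δ u v ≡ d → Distance u v d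
  δ≡⇒Distance {u} {v} refl = geodesic u v , δ≤walk

  Distance⇒δ≡ : ∀ {u v d} → Distance u v d → δ u v ≡ d
  Distance⇒δ≡ {u} {v} (p , shortest) = ≤-antisym (δ≤walk p) (shortest (geodesic u v))

-- Point sets closed under the Director's replies, and symmetries of the rectangle

-- A set of K points that the Director never needs to leave.
record Trap (a b K : ℕ) (v : Point) : Set₁ where
  field
    P        : Point → Set
    P⇒Box    : ∀ {z} → P z → Box a b z
    start    : P v
    reply    : ∀ {z w} → P z → Box a b w → ∃ λ z′ → P z′ × ρ z z′ ≡ ρ z w
    cover    : List Point
    P⇒∈cover : ∀ {z} → P z → z ∈ cover
    ∣cover∣  : length cover ≡ K

module _ {a b K : ℕ} where
  open ConnectedGraph (L (suc a) (suc b)) using (Distance; Guarantees; done; move; countDistinct; _≟_)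

  -- The Director answers from `P` at every turn, so all visited vertices have their coordinates in
  -- `cover`.
  trap-bound : ∀ {v j} → Trap a b K (coords v) → Guarantees j v [ v ] → j ≤ K
  trap-bound {v} {j} trap g = go g start (start ∷ [])
    where
    open Trap trap

    count≤K : ∀ {h} → All (P ∘ coords) h → countDistinct h ≤ K
    count≤K {h} h⊆P = subst (_≤ K) (length-map coords (deduplicate _≟_ h))
      (subst (length (map coords (deduplicate _≟_ h)) ≤_) ∣cover∣
        (unique-⊆⇒length-≤ (Unique.map⁺ coords-injective (DecUnique.deduplicate-! _≟_ h)) λ z∈ →
          let u , u∈ , z≡ = ∈-map⁻ coords z∈ in
          subst (_∈ cover) (sym z≡) (P⇒∈cover (All.lookup h⊆P (∈-deduplicate⁻ _≟_ h u∈)))))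

    go : ∀ {p h} → Guarantees j p h → P (coords p) → All (P ∘ coords) h → j ≤ K
    go (done c) _ h⊆P = ≤-trans c (count≤K h⊆P)
    go {p} (move d (w , δw) f) p∈ h⊆P with reply p∈ (coords-Box w)
    ... | z , z∈ , e with vertexAt (P⇒Box z∈)
    ...   | u , refl = go (f u (δ≡⇒Distance (trans e (Distance⇒δ≡ δw)))) z∈ (z∈ ∷ h⊆P)

-- The new set is the preimage of the old one under `σ`. The inverse laws are asked for only inside
-- the boxes because reflection uses truncated subtraction.
transport : ∀ {a b a′ b′ K v} (σ τ : Point → Point) →
            (∀ {z} → Box a b z → Box a′ b′ (σ z)) → (∀ {z} → Box a′ b′ z → Box a b (τ z)) →
            (∀ {z} → Box a b z → τ (σ z) ≡ z) → (∀ {z} → Box a′ b′ z → σ (τ z) ≡ z) →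
            (∀ {z w} → Box a b z → Box a b w → ρ (σ z) (σ w) ≡ ρ z w) →
            Box a b v → Trap a′ b′ K (σ v) → Trap a b K v
transport {a} {b} σ τ σ-Box τ-Box τσ στ isometry v-Box trap = record
  { P        = λ z → Box a b z × T.P (σ z)
  ; P⇒Box    = proj₁
  ; start    = v-Box , T.start
  ; reply    = λ {z} (z-Box , z∈) w-Box →
      let z′ , z′∈ , e = T.reply z∈ (σ-Box w-Box)
          z′-Box = T.P⇒Box z′∈
      in τ z′ , (τ-Box z′-Box , subst T.P (sym (στ z′-Box)) z′∈) ,
         trans (sym (isometry z-Box (τ-Box z′-Box)))
           (trans (cong (ρ (σ z)) (στ z′-Box)) (trans e (isometry z-Box w-Box)))
  ; cover    = map τ T.cover
  ; P⇒∈cover = λ (z-Box , z∈) → subst (_∈ map τ T.cover) (τσ z-Box) (∈-map⁺ τ (T.P⇒∈cover z∈))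
  ; ∣cover∣  = trans (length-map τ T.cover) T.∣cover∣
  }
  where module T = Trap trap

transpose : ∀ {a b K x y} → x ≤ a → y ≤ b → Trap b a K (y , x) → Trap a b K (x , y)
transpose x≤a y≤b = transport swap swap swap-Box swap-Box (λ _ → refl) (λ _ → refl)
  (λ {z} {w} _ _ → +-comm (∣ proj₂ z - proj₂ w ∣) _) (x≤a , y≤b)
  where
  swap : Point → Point
  swap (x , y) = y , x

  swap-Box : ∀ {a b z} → Box a b z → Box b a (swap z)
  swap-Box (p , q) = q , p

∣∸-∸∣ : ∀ {a x x′} → x ≤ a → x′ ≤ a → ∣ a ∸ x - a ∸ x′ ∣ ≡ ∣ x - x′ ∣
∣∸-∸∣ {a} {x} {x′} x≤a x′≤a = begin
  -- Adding `x′` turns the second entry into `a`, which is also `x + (a ∸ x)`; then `a ∸ x` cancels.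
  ∣ a ∸ x - a ∸ x′ ∣                           ≡⟨ ∣m+n-m+o∣≡∣n-o∣ x′ _ _ ⟨
  ∣ x′ + (a ∸ x) - x′ + (a ∸ x′) ∣             ≡⟨ cong (∣ x′ + (a ∸ x) -_∣) (trans (m+[n∸m]≡n x′≤a) (sym (m+[n∸m]≡n x≤a))) ⟩
  ∣ x′ + (a ∸ x) - x + (a ∸ x) ∣               ≡⟨ cong₂ ∣_-_∣ (+-comm x′ _) (+-comm x _) ⟩
  ∣ (a ∸ x) + x′ - (a ∸ x) + x ∣               ≡⟨ ∣m+n-m+o∣≡∣n-o∣ (a ∸ x) _ _ ⟩
  ∣ x′ - x ∣                                   ≡⟨ ∣-∣-comm x′ x ⟩
  ∣ x - x′ ∣                                   ∎
  where open ≡-Reasoning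

reflect : ∀ {a b K x y} → x ≤ a → y ≤ b → Trap a b K (a ∸ x , y) → Trap a b K (x , y)
reflect {a} {b} x≤a y≤b = transport σ σ σ-Box σ-Box involutive involutive
  (λ {z} {w} (p , _) (q , _) → cong (_+ ∣ proj₂ z - proj₂ w ∣) (∣∸-∸∣ p q)) (x≤a , y≤b)
  where
  σ : Point → Point
  σ (x , y) = a ∸ x , y

  σ-Box : ∀ {z} → Box a b z → Box a b (σ z)
  σ-Box {x , _} (_ , q) = m∸n≤m a x , q

  involutive : ∀ {z} → Box a b z → σ (σ z) ≡ z
  involutive (p , _) = cong (_, _) (m∸[m∸n]≡n p)

-- Farthest points and connected point sets

record Farthest₁ (a x f : ℕ) : Set where
  constructor farthest₁
  field bound : ∀ {x′} → x′ ≤ a → ∣ x - x′ ∣ ≤ ∣ x - f ∣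

record Farthest (a b : ℕ) (z f : Point) : Set where
  constructor farthest
  field bound : ∀ {w} → Box a b w → ρ z w ≤ ρ z f

module Connectivity (P : Point → Set) where
  Step : Point → Point → Set
  Step z w = P z × P w × ρ z w ≡ 1

  Step-sym : ∀ {z w} → Step z w → Step w z
  Step-sym {z} {w} (p , q , e) = q , p , trans (ρ-sym w z) e

  Connected : Point → Point → Set
  Connected = Star Step

  Connected-sym : ∀ {z w} → Connected z w → Connected w z
  Connected-sym = reverse Step-sym

  horizontal : ∀ {y} x k → (∀ i → i ≤ k → P (x + i , y)) → Connected (x , y) (x + k , y)
  horizontal {y} x zero p = subst (λ x′ → Connected (x , y) (x′ , y)) (sym (+-identityʳ x)) ε
  horizontal {y} x (suc k) p = subst (λ x′ → Connected (x , y) (x′ , y)) (sym (+-suc x k))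
    ((subst (λ x′ → P (x′ , y)) (+-identityʳ x) (p 0 z≤n) ,
      subst (λ x′ → P (x′ , y)) (+-comm x 1) (p 1 (s≤s z≤n)) ,
      cong₂ _+_ (trans (cong (∣ x -_∣) (+-comm 1 x)) (∣m-m+n∣≡n x 1)) (∣n-n∣≡0 y))
    ◅ horizontal (suc x) k λ i i≤k → subst (λ x′ → P (x′ , y)) (+-suc x i) (p (suc i) (s≤s i≤k)))

  vertical : ∀ {x} y k → (∀ i → i ≤ k → P (x , y + i)) → Connected (x , y) (x , y + k)
  vertical {x} y zero p = subst (λ y′ → Connected (x , y) (x , y′)) (sym (+-identityʳ y)) ε
  vertical {x} y (suc k) p = subst (λ y′ → Connected (x , y) (x , y′)) (sym (+-suc y k))
    ((subst (λ y′ → P (x , y′)) (+-identityʳ y) (p 0 z≤n) ,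
      subst (λ y′ → P (x , y′)) (+-comm y 1) (p 1 (s≤s z≤n)) ,
      cong₂ _+_ (∣n-n∣≡0 x) (trans (cong (∣ y -_∣) (+-comm 1 y)) (∣m-m+n∣≡n y 1)))
    ◅ vertical (suc y) k λ i i≤k → subst (λ y′ → P (x , y′)) (+-suc y i) (p (suc i) (s≤s i≤k)))

  -- Along a connection the distance to c changes by at most one per step ...
  intermediate : ∀ c {d z w} → P w → Connected z w → ρ c z ≤ d → d ≤ ρ c w → ∃ λ z′ → P z′ × ρ c z′ ≡ d
  intermediate c w∈ ε lo hi = _ , w∈ , ≤-antisym lo hi
  intermediate c {d} {z} w∈ (_◅_ {j = z′} (z∈ , _ , e) path) lo hi with m≤n⇒m<n∨m≡n lo
  ... | inj₂ eq = z , z∈ , eq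
  ... | inj₁ lt = intermediate c w∈ path (≤-trans (ρ-triangle c z z′)
    (≤-trans (≤-reflexive (trans (cong (ρ c z +_) e) (+-comm _ 1))) lt)) hi

  -- ... so a connected set containing with every point a farthest one is closed under the Director's replies.
  connected⇒reply : ∀ {a b o} → (∀ {z} → P z → Connected o z) →
    (∀ {z} → P z → ∃ λ f → P f × Farthest a b z f) →
    ∀ {z w} → P z → Box a b w → ∃ λ z′ → P z′ × ρ z z′ ≡ ρ z w
  connected⇒reply connect far {z} z∈ w-Box =
    let f , f∈ , farthest bound = far z∈ in
    intermediate z f∈ (Connected-sym (connect z∈) ◅◅ connect f∈)
      (≤-trans (≤-reflexive (ρ-refl z)) z≤n) (bound w-Box)

-- In the upper half `a ∸ x` is at most `x`, so neither side of `x` reaches farther than `0` does.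
farthest-0 : ∀ {a} x → a ≤ x + x → Farthest₁ a x 0
farthest-0 {a} x a≤2x = farthest₁ λ x′≤a → ≤-trans (bound x′≤a) (≤-reflexive (sym (∣-∣-identityʳ x)))
  where
  bound : ∀ {x′} → x′ ≤ a → ∣ x - x′ ∣ ≤ x
  bound {x′} x′≤a with ≤-total x x′
  ... | inj₁ x≤x′ = subst (_≤ x) (sym (m≤n⇒∣m-n∣≡n∸m x≤x′)) (m≤n+o⇒m∸n≤o x′ x (≤-trans x′≤a a≤2x))
  ... | inj₂ x′≤x = subst (_≤ x) (sym (trans (∣-∣-comm x x′) (m≤n⇒∣m-n∣≡n∸m x′≤x))) (m∸n≤m x x′)

farthest-end : ∀ {a} x → x + x ≤ a → Farthest₁ a x a
farthest-end {a} x 2x≤a = farthest₁ λ x′≤a →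
  ≤-trans (bound x′≤a) (≤-reflexive (sym (m≤n⇒∣m-n∣≡n∸m (≤-trans (m≤m+n x x) 2x≤a))))
  where
  bound : ∀ {x′} → x′ ≤ a → ∣ x - x′ ∣ ≤ a ∸ x
  bound {x′} x′≤a with ≤-total x x′
  ... | inj₁ x≤x′ = subst (_≤ a ∸ x) (sym (m≤n⇒∣m-n∣≡n∸m x≤x′)) (∸-monoˡ-≤ x x′≤a)
  ... | inj₂ x′≤x = ≤-trans (≤-reflexive (trans (∣-∣-comm x x′) (m≤n⇒∣m-n∣≡n∸m x′≤x)))
                      (≤-trans (m∸n≤m x x′) (m+n≤o⇒m≤o∸n x 2x≤a))

_,ᶠ_ : ∀ {a b x y f g} → Farthest₁ a x f → Farthest₁ b y g → Farthest a b (x , y) (f , g)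
farthest₁ p ,ᶠ farthest₁ q = farthest λ (x′≤a , y′≤b) → +-mono-≤ (p x′≤a) (q y′≤b)

-- The staircase along the middle column

module Staircase (h q r : ℕ) (q≤r : q ≤ r) where
  a b : ℕ
  a = h + h
  b = q + r

  -- Consecutive pieces share an endpoint, so this is a monotone path from `(0 , 0)` to `(a , b)`
  -- through the starting row `q` and the middle column `h`. By `q ≤ r` the row lies in the lower
  -- half.
  data P : Point → Set where
    left   : ∀ {y} → y ≤ q → P (0 , y)
    middle : ∀ {x} → x ≤ h → P (x , q)
    centre : ∀ {i} → i ≤ r → P (h , q + i)
    top    : ∀ {i} → i ≤ h → P (h + i , b)

  open Connectivity P

  to-left : ∀ {y} → y ≤ q → Connected (0 , 0) (0 , y)
  to-left {y} y≤q = vertical 0 y λ i i≤y → left (≤-trans i≤y y≤q)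

  to-middle : ∀ {x} → x ≤ h → Connected (0 , 0) (x , q)
  to-middle {x} x≤h = to-left ≤-refl ◅◅ horizontal 0 x λ i i≤x → middle (≤-trans i≤x x≤h)

  to-centre : ∀ {i} → i ≤ r → Connected (0 , 0) (h , q + i)
  to-centre {i} i≤r = to-middle ≤-refl ◅◅ vertical q i λ j j≤i → centre (≤-trans j≤i i≤r)

  to-top : ∀ {i} → i ≤ h → Connected (0 , 0) (h + i , b)
  to-top {i} i≤h = to-centre ≤-refl ◅◅ horizontal h i λ j j≤i → top (≤-trans j≤i i≤h)

  connect : ∀ {z} → P z → Connected (0 , 0) z
  connect (left p)   = to-left p
  connect (middle p) = to-middle p
  connect (centre p) = to-centre p
  connect (top p)    = to-top p

  first last : Point
  first = 0 , 0
  last  = a , b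

  far : ∀ {z} → P z → ∃ λ f → P f × Farthest a b z f
  far (left {y} y≤q) = last , top ≤-refl ,
    (farthest-end 0 z≤n ,ᶠ farthest-end y (+-mono-≤ y≤q (≤-trans y≤q q≤r)))
  far (middle {x} x≤h) = last , top ≤-refl ,
    (farthest-end x (+-mono-≤ x≤h x≤h) ,ᶠ farthest-end q (+-monoʳ-≤ q q≤r))
  -- Column `h` is equally far from both sides, so the height alone decides which end of the
  -- staircase is farthest.
  far (centre {i} i≤r) with ≤-total b ((q + i) + (q + i))
  ... | inj₁ le = first , left z≤n , (farthest-0 h ≤-refl ,ᶠ farthest-0 (q + i) le)
  ... | inj₂ ge = last , top ≤-refl , (farthest-end h ≤-refl ,ᶠ farthest-end (q + i) ge)
  far (top {i} i≤h) = first , left z≤n ,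
    (farthest-0 (h + i) (+-mono-≤ (m≤m+n h i) (m≤m+n h i)) ,ᶠ farthest-0 b (m≤m+n b b))

  -- Each bend is listed once: the left piece stops below row `q`, and the last two pieces omit
  -- their first point.
  cover : List Point
  cover = applyUpTo (0 ,_) q ++ applyUpTo (_, q) (suc h)
    ++ applyUpTo (λ i → h , q + suc i) r ++ applyUpTo (λ i → h + suc i , b) h

  ∈cover₂ : ∀ {z} → z ∈ applyUpTo (_, q) (suc h) → z ∈ cover
  ∈cover₂ = ∈-++⁺ʳ (applyUpTo (0 ,_) q) ∘ ∈-++⁺ˡ

  ∈cover₃ : ∀ {z} → z ∈ applyUpTo (λ i → h , q + suc i) r → z ∈ cover
  ∈cover₃ = ∈-++⁺ʳ (applyUpTo (0 ,_) q) ∘ ∈-++⁺ʳ (applyUpTo (_, q) (suc h)) ∘ ∈-++⁺ˡ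

  ∈cover₄ : ∀ {z} → z ∈ applyUpTo (λ i → h + suc i , b) h → z ∈ cover
  ∈cover₄ = ∈-++⁺ʳ (applyUpTo (0 ,_) q) ∘ ∈-++⁺ʳ (applyUpTo (_, q) (suc h))
    ∘ ∈-++⁺ʳ (applyUpTo (λ i → h , q + suc i) r)

  middle∈cover : ∀ {x} → x ≤ h → (x , q) ∈ cover
  middle∈cover x≤h = ∈cover₂ (∈-applyUpTo⁺ (_, q) (s≤s x≤h))

  centre∈cover : ∀ {i} → i ≤ r → (h , q + i) ∈ cover
  centre∈cover {zero} _    = subst (λ y → (h , y) ∈ cover) (sym (+-identityʳ q)) (middle∈cover ≤-refl)
  centre∈cover {suc i} i<r = ∈cover₃ (∈-applyUpTo⁺ (λ i → h , q + suc i) i<r)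

  P⇒∈cover : ∀ {z} → P z → z ∈ cover
  P⇒∈cover (left y≤q) with m≤n⇒m<n∨m≡n y≤q
  ... | inj₁ y<q  = ∈-++⁺ˡ (∈-applyUpTo⁺ (0 ,_) y<q)
  ... | inj₂ refl = middle∈cover z≤n
  P⇒∈cover (middle x≤h) = middle∈cover x≤h
  P⇒∈cover (centre i≤r) = centre∈cover i≤r
  P⇒∈cover (top {zero} _) = subst (λ x → (x , b) ∈ cover) (sym (+-identityʳ h)) (centre∈cover ≤-refl)
  P⇒∈cover (top {suc i} i<h) = ∈cover₄ (∈-applyUpTo⁺ (λ i → h + suc i , b) i<h)

  ∣cover∣ : length cover ≡ suc (a + b)
  ∣cover∣ = begin
    length cover
      ≡⟨ trans (length-++ (applyUpTo (0 ,_) q)) (cong₂ _+_ (length-applyUpTo _ q)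
         (trans (length-++ (applyUpTo (_, q) (suc h))) (cong₂ _+_ (length-applyUpTo (_, q) (suc h))
         (trans (length-++ (applyUpTo (λ i → h , q + suc i) r)) (cong₂ _+_ (length-applyUpTo _ r) (length-applyUpTo _ h)))))) ⟩
    q + (suc h + (r + h))
      ≡⟨ arith h q r ⟩
    suc (a + b) ∎
    where
    open ≡-Reasoning
    arith : ∀ h q r → q + (suc h + (r + h)) ≡ suc ((h + h) + (q + r))
    arith = solve-∀

  trap : ∀ {p} → p ≤ h → Trap a b (suc (a + b)) (p , q)
  trap p≤h = record
    { P        = P
    ; P⇒Box    = λ { (left y≤q)   → z≤n , ≤-trans y≤q (m≤m+n q r)
                   ; (middle x≤h) → ≤-trans x≤h (m≤m+n h h) , m≤m+n q r
                   ; (centre i≤r) → m≤m+n h h , +-monoʳ-≤ q i≤r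
                   ; (top i≤h)    → +-monoʳ-≤ h i≤h , ≤-refl }
    ; start    = middle p≤h
    ; reply    = connected⇒reply connect far
    ; cover    = cover
    ; P⇒∈cover = P⇒∈cover
    ; ∣cover∣  = ∣cover∣
    }

-- The row of the starting vertex with the two outer columns

module HShape (a q r : ℕ) where
  b : ℕ
  b = q + r

  data P : Point → Set where
    row   : ∀ {x} → x ≤ a → P (x , q)
    left  : ∀ {y} → y ≤ b → P (0 , y)
    right : ∀ {y} → y ≤ b → P (a , y)

  open Connectivity P

  to-left : ∀ {y} → y ≤ b → Connected (0 , 0) (0 , y)
  to-left {y} y≤b = vertical 0 y λ i i≤y → left (≤-trans i≤y y≤b)

  to-row : ∀ {x} → x ≤ a → Connected (0 , 0) (x , q)
  to-row {x} x≤a = to-left (m≤m+n q r) ◅◅ horizontal 0 x λ i i≤x → row (≤-trans i≤x x≤a)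

  connect : ∀ {z} → P z → Connected (0 , 0) z
  connect (left y≤b) = to-left y≤b
  connect (row x≤a)  = to-row x≤a
  connect (right {y} y≤b) = to-row ≤-refl
    ◅◅ Connected-sym (vertical 0 q λ i i≤q → right (≤-trans i≤q (m≤m+n q r)))
    ◅◅ vertical 0 y λ i i≤y → right (≤-trans i≤y y≤b)

  -- Some corner is always farthest, and the outer columns contain all four.
  far-corner : ∀ x y → ∃ λ f → P f × Farthest a b (x , y) f
  far-corner x y with ≤-total (x + x) a | ≤-total (y + y) b
  ... | inj₁ p | inj₁ q = (a , b) , right ≤-refl , (farthest-end x p ,ᶠ farthest-end y q)
  ... | inj₁ p | inj₂ q = (a , 0) , right z≤n , (farthest-end x p ,ᶠ farthest-0 y q)
  ... | inj₂ p | inj₁ q = (0 , b) , left ≤-refl , (farthest-0 x p ,ᶠ farthest-end y q)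
  ... | inj₂ p | inj₂ q = (0 , 0) , left z≤n , (farthest-0 x p ,ᶠ farthest-0 y q)

  P⇒Box : ∀ {z} → P z → Box a b z
  P⇒Box (row x≤a)   = x≤a , m≤m+n q r
  P⇒Box (left y≤b)  = z≤n , y≤b
  P⇒Box (right y≤b) = ≤-refl , y≤b

  -- The point of the column on row `q` is left out because the list of the row already has it.
  punctured : ℕ → List Point
  punctured x = applyUpTo (x ,_) q ++ applyUpTo (λ i → x , q + suc i) r

  cover : List Point
  cover = applyUpTo (_, q) (suc a) ++ punctured 0 ++ punctured a

  column : ∀ {x y} → (∀ {z} → z ∈ punctured x → z ∈ cover) → x ≤ a → y ≤ b → (x , y) ∈ cover
  column {x} {y} sub x≤a y≤b with ≤-total y q
  ... | inj₁ y≤q with m≤n⇒m<n∨m≡n y≤q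
  ...   | inj₁ y<q  = sub (∈-++⁺ˡ (∈-applyUpTo⁺ (x ,_) y<q))
  ...   | inj₂ refl = ∈-++⁺ˡ (∈-applyUpTo⁺ (_, q) (s≤s x≤a))
  column {x} {y} sub x≤a y≤b | inj₂ q≤y with m≤n⇒∃[o]m+o≡n q≤y
  ... | zero  , refl = subst (λ y → (x , y) ∈ cover) (sym (+-identityʳ q)) (∈-++⁺ˡ (∈-applyUpTo⁺ (_, q) (s≤s x≤a)))
  ... | suc i , refl = sub (∈-++⁺ʳ (applyUpTo (x ,_) q) (∈-applyUpTo⁺ _ (+-cancelˡ-≤ q _ _ y≤b)))

  P⇒∈cover : ∀ {z} → P z → z ∈ cover
  P⇒∈cover (row x≤a)   = ∈-++⁺ˡ (∈-applyUpTo⁺ (_, q) (s≤s x≤a))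
  P⇒∈cover (left y≤b)  = column (∈-++⁺ʳ (applyUpTo (_, q) (suc a)) ∘ ∈-++⁺ˡ) z≤n y≤b
  P⇒∈cover (right y≤b) = column (∈-++⁺ʳ (applyUpTo (_, q) (suc a)) ∘ ∈-++⁺ʳ (punctured 0)) ≤-refl y≤b

  ∣punctured∣ : ∀ x → length (punctured x) ≡ b
  ∣punctured∣ x = trans (length-++ (applyUpTo (x ,_) q)) (cong₂ _+_ (length-applyUpTo _ q) (length-applyUpTo _ r))

  ∣cover∣ : length cover ≡ suc a + (b + b)
  ∣cover∣ = trans (length-++ (applyUpTo (_, q) (suc a))) (cong₂ _+_ (length-applyUpTo (_, q) (suc a))
    (trans (length-++ (punctured 0)) (cong₂ _+_ (∣punctured∣ 0) (∣punctured∣ a))))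

  trap : ∀ {p} → p ≤ a → Trap a b (suc a + (b + b)) (p , q)
  trap p≤a = record
    { P        = P
    ; P⇒Box    = P⇒Box
    ; start    = row p≤a
    ; reply    = connected⇒reply connect λ {z} _ → far-corner (proj₁ z) (proj₂ z)
    ; cover    = cover
    ; P⇒∈cover = P⇒∈cover
    ; ∣cover∣  = ∣cover∣
    }

-- Traps for an arbitrary starting vertex

trap-general : ∀ {a b x y} → x ≤ a → y ≤ b → Trap a b (suc a + (b + b)) (x , y)
trap-general {a} {y = y} x≤a y≤b with m≤n⇒∃[o]m+o≡n y≤b
... | r , refl = HShape.trap a y r x≤a

-- The staircase needs its start in the lower left quarter; reflecting one or both coordinates moves
-- any vertex there.
trap-even : ∀ h {b x y} → x ≤ h + h → y ≤ b → Trap (h + h) b (suc ((h + h) + b)) (x , y)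
trap-even h {b} {x} {y} x≤a y≤b = fromX
  where
  lower-left : ∀ {x y} → x ≤ h → y ≤ b → y + y ≤ b → Trap (h + h) b (suc ((h + h) + b)) (x , y)
  lower-left {y = y} x≤h y≤b 2y≤b with m≤n⇒∃[o]m+o≡n y≤b
  ... | r , refl = Staircase.trap h y r (+-cancelˡ-≤ y _ _ 2y≤b) x≤h

  fromY : ∀ {x} → x ≤ h → Trap (h + h) b (suc ((h + h) + b)) (x , y)
  fromY {x} x≤h with ≤-total (y + y) b
  ... | inj₁ 2y≤b = lower-left x≤h y≤b 2y≤b
  -- Reflection of the second coordinate is `reflect` conjugated by `transpose`.
  ... | inj₂ b≤2y = transpose (≤-trans x≤h (m≤m+n h h)) y≤b (reflect y≤b (≤-trans x≤h (m≤m+n h h))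
      (transpose (m∸n≤m b y) (≤-trans x≤h (m≤m+n h h))
        (lower-left x≤h (m∸n≤m b y)
          (≤-trans (+-monoˡ-≤ (b ∸ y) (m≤n+o⇒m∸n≤o b y b≤2y)) (≤-reflexive (m+[n∸m]≡n y≤b))))))

  fromX : Trap (h + h) b (suc ((h + h) + b)) (x , y)
  fromX with ≤-total x h
  ... | inj₁ x≤h = fromY x≤h
  ... | inj₂ h≤x = reflect x≤a y≤b (fromY (m≤n+o⇒m∸n≤o (h + h) x (+-monoˡ-≤ h h≤x)))

-- Ends and eccentricities on a path

module Line (a : ℕ) where
  -- Naming the ends by booleans makes `not` the opposite end and lets `xor` tell the diagonals of
  -- the rectangle apart.
  end : Bool → Fin (suc a)
  end false = zero
  end true  = fromℕ a

  ∣a-x∣ : ∀ (x : Fin (suc a)) → ∣ toℕ (fromℕ a) - toℕ x ∣ ≡ a ∸ toℕ x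
  ∣a-x∣ x = trans (cong (∣_- toℕ x ∣) (Fin.toℕ-fromℕ a))
    (trans (∣-∣-comm a (toℕ x)) (m≤n⇒∣m-n∣≡n∸m (Fin.toℕ≤pred[n] x)))

  end-sum : ∀ e (x : Fin (suc a)) → ∣ toℕ (end e) - toℕ x ∣ + ∣ toℕ (end (not e)) - toℕ x ∣ ≡ a
  end-sum false x = trans (cong (toℕ x +_) (∣a-x∣ x)) (m+[n∸m]≡n (Fin.toℕ≤pred[n] x))
  end-sum true  x = trans (cong (_+ toℕ x) (∣a-x∣ x)) (m∸n+n≡m (Fin.toℕ≤pred[n] x))

  at-distance : ∀ e {k} → k ≤ a → ∃ λ (x : Fin (suc a)) → ∣ toℕ (end e) - toℕ x ∣ ≡ k
  at-distance false k≤a = fromℕ< (s≤s k≤a) , Fin.toℕ-fromℕ< (s≤s k≤a)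
  at-distance true {k} k≤a = let x = fromℕ< (s≤s (m∸n≤m a k)) in
    x , trans (∣a-x∣ x) (trans (cong (a ∸_) (Fin.toℕ-fromℕ< (s≤s (m∸n≤m a k)))) (m∸[m∸n]≡n k≤a))

  ecc : Fin (suc a) → ℕ
  ecc x = toℕ x ⊔ (a ∸ toℕ x)

  a≤2ecc : ∀ x → a ≤ ecc x + ecc x
  a≤2ecc x = ≤-trans (≤-reflexive (sym (m+[n∸m]≡n (Fin.toℕ≤pred[n] x))))
    (+-mono-≤ (m≤m⊔n (toℕ x) _) (m≤n⊔m (toℕ x) _))

  ecc-attained : ∀ x → ∃ λ e → ∣ toℕ x - toℕ (end e) ∣ ≡ ecc x
  ecc-attained x with ⊔-sel (toℕ x) (a ∸ toℕ x)
  ... | inj₁ e = false , trans (∣-∣-identityʳ (toℕ x)) (sym e)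
  ... | inj₂ e = true , trans (∣-∣-comm (toℕ x) _) (trans (∣a-x∣ x) (sym e))

  -- An inner `y` can be moved one step further away from `x`, so only an end can be at distance
  -- `ecc x`.
  end⊎<ecc : ∀ x y → (∃ λ e → y ≡ end e) ⊎ ∣ toℕ x - toℕ y ∣ < ecc x
  end⊎<ecc x zero = inj₁ (false , refl)
  end⊎<ecc x y@(suc _) with m≤n⇒m<n∨m≡n (Fin.toℕ≤pred[n] y) | ≤-total (toℕ x) (toℕ y)
  ... | inj₂ e   | _ = inj₁ (true , Fin.toℕ-injective (trans e (sym (Fin.toℕ-fromℕ a))))
  ... | inj₁ y<a | inj₁ x≤y = inj₂ (≤-trans (s≤s (≤-reflexive (m≤n⇒∣m-n∣≡n∸m x≤y)))
          (≤-trans (∸-monoˡ-< y<a x≤y) (m≤n⊔m (toℕ x) _)))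
  ... | inj₁ _   | inj₂ y≤x = inj₂ (≤-trans
          (s≤s (≤-reflexive (trans (∣-∣-comm (toℕ x) (toℕ y)) (m≤n⇒∣m-n∣≡n∸m y≤x))))
          (≤-trans (∸-monoʳ-< {toℕ x} {toℕ y} {0} (s≤s z≤n) y≤x) (m≤m⊔n (toℕ x) _)))

  end≤ecc : ∀ x e → ∣ toℕ x - toℕ (end e) ∣ ≤ ecc x
  end≤ecc x false = ≤-trans (≤-reflexive (∣-∣-identityʳ (toℕ x))) (m≤m⊔n (toℕ x) _)
  end≤ecc x true  = ≤-trans (≤-reflexive (trans (∣-∣-comm (toℕ x) _) (∣a-x∣ x))) (m≤n⊔m (toℕ x) _)

  ∣x-y∣≤ecc : ∀ x y → ∣ toℕ x - toℕ y ∣ ≤ ecc x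
  ∣x-y∣≤ecc x y with end⊎<ecc x y
  ... | inj₁ (e , refl) = end≤ecc x e
  ... | inj₂ lt         = <⇒≤ lt

double : ∀ k → k + k ≡ k * 2
double = solve-∀

-- Corners, diagonals and their levels

module Explorer (a b : ℕ) where
  private
    module X = Line a
    module Y = Line b
    G = L (suc a) (suc b)
    N = a + b

  V : Set
  V = Vertex (suc a) (suc b)

  open ConnectedGraph G using (Distance; Guarantees; done; move; countDistinct; _≟_)
  open GameValue G using (count-fresh; count-mono; Guarantees-mono)
  open DecMembership _≟_ using (_∈?_)

  corner : Bool → Bool → V
  corner e f = X.end e , Y.end f

  ecc : V → ℕ
  ecc (x , y) = X.ecc x + Y.ecc y

  ecc-attained : ∀ u → ∃ λ c → δ u c ≡ ecc u
  ecc-attained (x , y) = let e , p = X.ecc-attained x ; f , q = Y.ecc-attained y in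
    corner e f , cong₂ _+_ p q

  -- A shortfall in one coordinate cannot be made up in the other. Hence the only replies to a named
  -- eccentricity are corners.
  farthest⇒corner : ∀ u c → δ u c ≡ ecc u → ∃ λ e → ∃ λ f → c ≡ corner e f
  farthest⇒corner (x , y) (x′ , y′) eq with X.end⊎<ecc x x′ | Y.end⊎<ecc y y′
  ... | inj₁ (e , p) | inj₁ (f , q) = e , f , cong₂ _,_ p q
  ... | inj₂ lt      | _            = ⊥-elim (<⇒≢ (+-mono-<-≤ lt (Y.∣x-y∣≤ecc y y′)) eq)
  ... | inj₁ _       | inj₂ lt      = ⊥-elim (<⇒≢ (+-mono-≤-< (X.∣x-y∣≤ecc x x′) lt) eq)

  -- This makes level `d` of a corner the level `N ∸ d` of the opposite one.
  opposite-sum : ∀ e f u → δ (corner e f) u + δ (corner (not e) (not f)) u ≡ N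
  opposite-sum e f (x , y) = trans (+-interchange (∣ toℕ (X.end e) - toℕ x ∣) _ _ _)
    (cong₂ _+_ (X.end-sum e x) (Y.end-sum f y))

  at-distance : ∀ e f {d} → d ≤ N → ∃ λ u → δ (corner e f) u ≡ d
  at-distance e f {d} d≤N =
    -- The distance is spent on the first coordinate as far as it goes, and the excess `d ∸ a` on
    -- the second.
    let x , p = X.at-distance e (m⊓n≤m a d)
        y , q = Y.at-distance f (m≤n+o⇒m∸n≤o d a d≤N)
    in (x , y) , trans (cong₂ _+_ p q) (m⊓n+n∸m≡n a d)

  -- `s` names a diagonal: the corner `(e , f)` lies on diagonal `e xor f`, and levels are counted
  -- from its end in row `0`.
  level : Bool → V → ℕ
  level s = δ (corner s false)

  Forces : V → (V → ℕ) → ℕ → Set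
  Forces c f k = ∃ λ d → (∃ λ u → Distance c u d) × (∀ u → Distance c u d → f u ≡ k)

  forces-near : ∀ e f {k} → k ≤ N → Forces (corner e f) (δ (corner e f)) k
  forces-near e f {k} k≤N = let u , p = at-distance e f k≤N in
    k , (u , δ≡⇒Distance p) , λ _ → Distance⇒δ≡

  forces-far : ∀ e f {k} → k ≤ N → Forces (corner (not e) (not f)) (δ (corner e f)) k
  forces-far e f {k} k≤N = let u , p = at-distance (not e) (not f) (m∸n≤m N k) in
    N ∸ k , (u , δ≡⇒Distance p) , λ u p → +-cancelʳ-≡ (N ∸ k) _ k
      (trans (trans (cong (δ (corner e f) u +_) (sym (Distance⇒δ≡ p))) (opposite-sum e f u)) (sym (m+[n∸m]≡n k≤N)))

  -- At a corner with `f = true` the level is counted from the opposite corner, so the Explorer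
  -- names `N ∸ k` there.
  forces : ∀ e f {k} → k ≤ N → Forces (corner e f) (level (e xor f)) k
  forces false false = forces-near false false
  forces true  false = forces-near true false
  forces false true  = forces-far true false
  forces true  true  = forces-far false false

  -- The middle level is equally far from both corners of its diagonal, whichever end it is counted
  -- from.
  half-level : ∀ e f u {K} → K + K ≡ N → level (e xor f) u ≡ K → δ (corner e f) u ≡ K
  half-level false false u _ p = p
  half-level true  false u _ p = p
  half-level false true  u {K} q p = +-cancelʳ-≡ K _ K
    (trans (cong (δ (corner false true) u +_) (sym p)) (trans (opposite-sum false true u) (sym q)))
  half-level true  true  u {K} q p = +-cancelʳ-≡ K _ K
    (trans (cong (δ (corner true true) u +_) (sym p)) (trans (opposite-sum true true u) (sym q)))

  Missing : (V → ℕ) → ℕ → List V → Set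
  Missing f K h = ∃ λ k → k < K × (∀ {u} → u ∈ h → f u ≢ k)

  pigeonhole : ∀ f K h → countDistinct h < K → Missing f K h
  pigeonhole f K h count<K with All.all? (λ k → DecMembership._∈?_ ℕ._≟_ k (map f h)) (upTo K)
  ... | no ¬all = let k , k∈ , k∉ = find (¬All⇒Any¬ (λ k → DecMembership._∈?_ ℕ._≟_ k (map f h)) _ ¬all) in
    k , ∈-upTo⁻ k∈ , λ u∈ e → k∉ (subst (_∈ map f h) e (∈-map⁺ f u∈))
  ... | yes all = ⊥-elim (<⇒≱ count<K K≤count)
    where
    K≤count : K ≤ countDistinct h
    K≤count = subst (_≤ countDistinct h) (length-upTo K)
      (≤-trans (unique-⊆⇒length-≤ (Unique.upTo⁺ K) λ k∈ →
         let u , u∈ , k≡ = ∈-map⁻ f (All.lookup all k∈) in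
         subst (_∈ map f (deduplicate _≟_ h)) (sym k≡) (∈-map⁺ f (∈-deduplicate⁺ _≟_ u∈)))
       (≤-reflexive (length-map f (deduplicate _≟_ h))))

  Switchable : Set
  Switchable = ∃ λ K → K + K ≡ N × (∀ u → ecc u ≢ K)

  -- Moves of the Explorer between corners

  module Strategy (k : ℕ) where
    -- The induction hypothesis of `play`, handed to the individual moves as an argument.
    Progress : List V → Set
    Progress h = ∀ e f {h′} → countDistinct h < countDistinct h′ → Guarantees k (corner e f) h′

    -- The continuation learns that its corner is farthest from `u`; `switch` uses this to exclude
    -- one diagonal.
    retreat : ∀ {u h} → (∀ e f → δ u (corner e f) ≡ ecc u → Guarantees k (corner e f) (corner e f ∷ h)) →
              Guarantees k u h
    retreat {u} {h} g = let c , p = ecc-attained u in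
      move (ecc u) (c , δ≡⇒Distance p) λ c p → land c (Distance⇒δ≡ p)
      where
      land : ∀ c → δ u c ≡ ecc u → Guarantees k c (c ∷ h)
      land c p with farthest⇒corner u c p
      ... | e , f , refl = g e f p

    -- From a new vertex the Explorer retreats to a corner with a larger count. An old vertex leaves
    -- the set of visited vertices unchanged, so the caller continues with `h` and its unvisited
    -- levels.
    visit : ∀ {u h} → Progress h → (u ∈ h → Guarantees k u h) → Guarantees k u (u ∷ h)
    visit {u} {h} progress old with u ∈? h
    ... | yes u∈ = Guarantees-mono there (old u∈)
    ... | no  u∉ = retreat λ e f _ → progress e f (≤-trans (count-fresh {u} {h} u∉) (count-mono (u ∷ h) (corner e f ∷ u ∷ h) there))

    attack : ∀ {h} e f → Progress h → Missing (level (e xor f)) (suc N) h → Guarantees k (corner e f) h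
    attack e f progress (_ , s≤s j≤N , unvisited) = let d , reachable , land = forces e f j≤N in
      move d reachable λ u p → visit progress λ u∈ → ⊥-elim (unvisited u∈ (land u p))

    -- The eccentricity of a vertex on the middle level of a diagonal exceeds its distance to the two
    -- corners on that diagonal, so a retreat from there ends on the other diagonal.
    switch : ∀ {h} e f → Progress h → Switchable → Missing (level (not (e xor f))) (suc N) h →
             Guarantees k (corner e f) h
    switch {h} e f progress (K , 2K≡N , ecc≢K) missing =
      let d , reachable , land = forces e f (≤-trans (m≤m+n K K) (≤-reflexive 2K≡N)) in
      move d reachable λ u p → visit progress λ _ → retreat λ e′ f′ q → visit progress λ _ →
        attack e′ f′ progress (subst (λ s → Missing (level s) (suc N) h)
          (sym (Bool.¬-not {e′ xor f′} {e xor f} (λ s≡ → ecc≢K u (trans (sym q)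
            (trans (ρ-sym (coords u) (coords (corner e′ f′)))
              (half-level e′ f′ u 2K≡N (trans (cong (λ s → level s u) s≡) (land u p))))))))
          missing)

    -- The two lower bounds differ only in `k` and this oracle, which finds an unvisited level on
    -- the current diagonal `s`, or on the other one together with the means to switch.
    module _ (oracle : ∀ h → countDistinct h < k → ∀ s →
                Missing (level s) (suc N) h ⊎ (Missing (level (not s)) (suc N) h × Switchable)) where

      -- `fuel` bounds the number of new vertices still required; each attack or switch yields at
      -- least one.
      play : ∀ fuel e f {h} → k ≤ fuel + countDistinct h → Guarantees k (corner e f) h
      play zero e f le = done le
      play (suc fuel) e f {h} le with k ≤? countDistinct h
      ... | yes c = done c
      ... | no ¬c = [ attack e f progress , (λ (missing , switchable) → switch e f progress switchable missing) ]′
                      (oracle h (≰⇒> ¬c) (e xor f))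
        where
        progress : Progress h
        progress e f lt = play fuel e f (≤-trans le (≤-trans (≤-reflexive (sym (+-suc fuel _))) (+-monoʳ-≤ fuel lt)))

      win : ∀ v → Guarantees k v [ v ]
      win v = retreat λ e f _ → play k e f (m≤m+n k _)

  guarantees-general : ∀ v → Guarantees (suc N) v [ v ]
  guarantees-general = Strategy.win (suc N) λ h lt s → inj₁ (pigeonhole (level s) (suc N) h lt)

  -- Both sides even: counting even levels

  module _ (2∣1+a : 2 ∣ suc a) (2∣1+b : 2 ∣ suc b) where
    2∤a : ¬ (2 ∣ a)
    2∤a 2∣a with ∣1⇒≡1 (∣m+n∣m⇒∣n (subst (2 ∣_) (+-comm 1 a) 2∣1+a) 2∣a)
    ... | ()

    2∣N : 2 ∣ N
    2∣N = ∣m+n∣m⇒∣n {m = 2} (subst (2 ∣_) (cong suc (+-suc a b)) (∣m∣n⇒∣m+n 2∣1+a 2∣1+b)) ∣-refl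

    -- As `a` is odd, `a` is strictly below twice the eccentricity in the first coordinate. Adding
    -- the second coordinate gives `N < ecc u + ecc u`, while `N` is twice `K`.
    switchable : Switchable
    switchable with 2∣N
    ... | divides K N≡K*2 = K , trans (double K) (sym N≡K*2) , λ u ecc≡K →
        <⇒≢ (N<2ecc u) (trans N≡K*2 (trans (sym (double K)) (sym (cong₂ _+_ ecc≡K ecc≡K))))
      where
      a<2ecc : ∀ x → a < X.ecc x + X.ecc x
      a<2ecc x = ≤∧≢⇒< (X.a≤2ecc x) λ a≡ → 2∤a (divides (X.ecc x) (trans a≡ (double (X.ecc x))))

      N<2ecc : ∀ u → N < ecc u + ecc u
      N<2ecc (x , y) = ≤-trans (+-mono-<-≤ (a<2ecc x) (Y.a≤2ecc y))
        (≤-reflexive (+-interchange (X.ecc x) _ (Y.ecc y) _))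

    -- The right side has the parity of `a`, which is odd, so exactly one of the two levels of a
    -- vertex is even.
    level-sum : ∀ u → level false u + level true u ≡ a + (toℕ (proj₂ u) + toℕ (proj₂ u))
    level-sum (x , y) = trans (+-interchange (toℕ x) _ _ _) (cong (_+ (toℕ y + toℕ y)) (X.end-sum false x))

    -- Even values are the even levels of one diagonal, odd values are one more than those of the other.
    evenLevel : V → ℕ
    evenLevel u with 2 ∣? level false u
    ... | yes _ = level false u
    ... | no  _ = suc (level true u)

    evenLevel-false : ∀ u → 2 ∣ level false u → evenLevel u ≡ level false u
    evenLevel-false u 2∣s with 2 ∣? level false u
    ... | yes _  = refl
    ... | no 2∤s = ⊥-elim (2∤s 2∣s)

    evenLevel-true : ∀ u → 2 ∣ level true u → evenLevel u ≡ suc (level true u)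
    evenLevel-true u@(_ , y) 2∣t with 2 ∣? level false u
    ... | no _    = refl
    ... | yes 2∣s = ⊥-elim (2∤a (∣m+n∣m⇒∣n {m = toℕ y + toℕ y}
            (subst (2 ∣_) (trans (level-sum u) (+-comm a _)) (∣m∣n⇒∣m+n 2∣s 2∣t))
            (divides (toℕ y) (double (toℕ y)))))

    odd-pred : ∀ k → ¬ (2 ∣ k) → ∃ λ j → k ≡ suc j × 2 ∣ j
    odd-pred zero          2∤k = ⊥-elim (2∤k (divides 0 refl))
    odd-pred (suc zero)    _   = 0 , refl , divides 0 refl
    odd-pred (suc (suc k)) 2∤k with odd-pred k (λ 2∣k → 2∤k (∣m∣n⇒∣m+n ∣-refl 2∣k))
    ... | j , refl , 2∣j = 2 + j , refl , ∣m∣n⇒∣m+n ∣-refl 2∣j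

    -- Fewer than `N + 2` vertices leave out some value `k ≤ N + 1` of `evenLevel`. An even `k` is a
    -- missing level of diagonal `false`, as `N + 1` is odd; an odd `k` is one more than a missing
    -- level of diagonal `true`.
    missing-level : ∀ h → countDistinct h < suc (suc N) → ∃ λ s → Missing (level s) (suc N) h
    missing-level h lt with pigeonhole evenLevel (suc (suc N)) h lt
    ... | k , s≤s k≤1+N , unvisited with 2 ∣? k
    ...   | yes 2∣k = false , k , ≤∧≢⇒< k≤1+N k≢1+N ,
              λ {u} u∈ e → unvisited u∈ (trans (evenLevel-false u (subst (2 ∣_) (sym e) 2∣k)) e)
      where
      k≢1+N : k ≢ suc N
      k≢1+N refl with ∣1⇒≡1 (∣m+n∣m⇒∣n {m = N} (subst (2 ∣_) (+-comm 1 N) 2∣k) 2∣N)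
      ... | ()
    ...   | no 2∤k with odd-pred k 2∤k
    ...     | j , refl , 2∣j = true , j , k≤1+N ,
              λ {u} u∈ e → unvisited u∈ (trans (evenLevel-true u (subst (2 ∣_) (sym e) 2∣j)) (cong suc e))

    guarantees-even : ∀ v → Guarantees (suc (suc N)) v [ v ]
    guarantees-even = Strategy.win (suc (suc N)) oracle
      where
      oracle : ∀ h → countDistinct h < suc (suc N) → ∀ s →
               Missing (level s) (suc N) h ⊎ (Missing (level (not s)) (suc N) h × Switchable)
      oracle h lt s with missing-level h lt
      ... | s′ , missing with s′ Bool.≟ s
      ...   | yes refl = inj₁ missing
      ...   | no s′≢s  = inj₂ (subst (λ s → Missing (level s) (suc N) h) (Bool.¬-not s′≢s) missing , switchable)

-- Parity of the side lengths and the final bounds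

even⊎odd : ∀ a → (∃ λ h → a ≡ h + h) ⊎ 2 ∣ suc a
even⊎odd zero = inj₁ (0 , refl)
even⊎odd (suc a) with even⊎odd a
... | inj₁ (h , refl)            = inj₂ (divides (suc h) (cong (2 +_) (double h)))
... | inj₂ (divides (suc h) eq) = inj₁ (suc h , trans eq (sym (double (suc h))))

trap-odd : ∀ {a b x y} → ¬ (2 ∣ suc a) ⊎ ¬ (2 ∣ suc b) → x ≤ a → y ≤ b → Trap a b (suc (a + b)) (x , y)
trap-odd {a} (inj₁ 2∤1+a) x≤a y≤b with even⊎odd a
... | inj₁ (h , refl) = trap-even h x≤a y≤b
... | inj₂ 2∣1+a      = ⊥-elim (2∤1+a 2∣1+a)
trap-odd {a} {b} {x} {y} (inj₂ 2∤1+b) x≤a y≤b with even⊎odd b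
... | inj₁ (h , refl) = transpose x≤a y≤b (subst (λ k → Trap b a (suc k) (y , x)) (+-comm b a) (trap-even h y≤b x≤a))
... | inj₂ 2∣1+b      = ⊥-elim (2∤1+b 2∣1+b)

theorem3p1 : ∀ (n m : ℕ) → 2 ≤ m → m ≤ n → (v : ConnectedGraph.V (L n m)) →
    (((¬ (2 ∣ n)) ⊎ (¬ (2 ∣ m))) → gameValue (L n m) v ≡ (n + m) ∸ 1)
    × ((2 ∣ n) × (2 ∣ m) →
    (n + m ≤ gameValue (L n m) v) × (gameValue (L n m) v ≤ (2 * m + n) ∸ 2))
theorem3p1 (suc a) (suc b) _ _ v = odd , even
  where
  open ConnectedGraph (L (suc a) (suc b)) using (Guarantees)

  guaranteed : Guarantees (gameValue (L (suc a) (suc b)) v) v [ v ]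
  guaranteed = proj₁ (gameValue-isGameValue (L (suc a) (suc b)) v)

  maximal : ∀ j → Guarantees j v [ v ] → j ≤ gameValue (L (suc a) (suc b)) v
  maximal = proj₂ (gameValue-isGameValue (L (suc a) (suc b)) v)

  x≤a = proj₁ (coords-Box v)
  y≤b = proj₂ (coords-Box v)

  -- `(suc a + suc b) ∸ 1` computes to `a + suc b`, whereas both players' bounds read `suc (a + b)`.
  odd : ¬ (2 ∣ suc a) ⊎ ¬ (2 ∣ suc b) → gameValue (L (suc a) (suc b)) v ≡ a + suc b
  odd o = trans
    (≤-antisym (trap-bound (trap-odd o x≤a y≤b) guaranteed)
               (maximal _ (Explorer.guarantees-general a b v)))
    (sym (+-suc a b))

  even : 2 ∣ suc a × 2 ∣ suc b →
         suc a + suc b ≤ gameValue (L (suc a) (suc b)) v × gameValue (L (suc a) (suc b)) v ≤ (2 * suc b + suc a) ∸ 2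
  even (2∣1+a , 2∣1+b) =
    subst (_≤ gameValue (L (suc a) (suc b)) v) (cong suc (sym (+-suc a b)))
      (maximal _ (Explorer.guarantees-even a b 2∣1+a 2∣1+b v)) ,
    -- `_∸ 2` computes on the left side of `size`, leaving the trap size `suc a + (b + b)`.
    subst (gameValue (L (suc a) (suc b)) v ≤_) (cong (_∸ 2) (size a b)) (trap-bound (trap-general x≤a y≤b) guaranteed)
    where
    size : ∀ a b → 2 + (suc a + (b + b)) ≡ 2 * suc b + suc a
    size = solve-∀
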